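{- Let $(G,c)$ be a payment network and let $D$ be a spanning representation of it, with represented score map $S_D$. Then: (1) Any two cycle-equivalent configurations have the same represented score. (2) If a transaction of size $k$ routed along a path $p$ takes configuration $w_1$ to configuration $w_2$, then $S_D(w_1)-k\,D(p)=S_D(w_2)$. (3) If two paths $p$ and $q$ both go from vertex $x$ to vertex $y$, then $D(p)=D(q)$.
   Context: A payment network consists of a finite connected simple undirected graph $G=(V,E)$ and capacities $c:E\to\mathbb{R}_{\ge 0}$, $c(u,v)=c(v,u)$. Put $n=|V|-1$. A configuration is a map $w:V\times V\to\mathbb{R}_{\ge0}$ with $w(u,v)+w(v,u)=c(u,v)$ for every edge $(u,v)$ (and $w=0$ on non-adjacent pairs). A flow $f=(f_{(u,v)})$ assigns nonnegative numbers to ordered adjacent pairs; it is feasible in $w$ if $f_{(u,v)}\le w(u,v)$ for all $(u,v)$, and executing it changes $w$ to $w'(u,v)=w(u,v)-f_{(u,v)}+f_{(v,u)}$. A path is a walk $(v_0,\dots,v_t)$ in $G$ and is a cycle if $v_0=v_t$. Routing a transaction (payment) of size $k$ along a path means executing the (feasible) flow that assigns to each ordered pair $k$ times the number of times the path traverses it. Two configurations are cycle-equivalent if one is reachable from the other by routing a series of payments along cycles. Fix an orientation $s:V\times V\to\{\pm1\}$ with $s(u,v)=-s(v,u)$ on edges. For $D:E\to\mathbb{R}^n$ the direction of a path is $D(p)=\sum_{i=0}^{t-1}s(v_i,v_{i+1})D(v_i,v_{i+1})$. $D$ is a spanning representation if (1) for every path $p$, $D(p)=0$ iff $p$ is a cycle,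 and (2) for every spanning tree $T$, $\{D(t)\}_{t\in T}$ spans $\mathbb{R}^n$. The represented score of $w$ is $S_D(w)=\sum_{(u,v):\,s(u,v)=1}w(u,v)D(u,v)$, the sum being over ordered pairs that are edges taken in their positive direction. -}

module Defs where

open import Algebra.Bundles using (AbelianGroup; CommutativeRing)
open import Algebra.Apartness.Bundles using (HeytingField; HeytingCommutativeRing)
import Algebra.Construct.Pointwise as Pointwise
import Algebra.Definitions.RawMonoid as RawMonoidDefs
open import Data.Bool.Base using (if_then_else_; _∧_)
open import Data.Fin.Base using (Fin)
open import Data.Fin.Properties using (_≟_)
open import Data.List.Base using (List; []; _∷_; length; foldr)
open import Data.List.Relation.Unary.Unique.Propositional using (Unique)
open import Data.Nat.Base as ℕ using (ℕ; zero; suc)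
open import Data.Product.Base using (Σ-syntax; ∃-syntax; ∃₂; _×_; _,_)
open import Data.Sign.Base as Sign using (Sign)
open import Data.Sum.Base using (_⊎_)
open import Function.Bundles using (_⇔_)
open import Level using (Level; _⊔_; 0ℓ) renaming (suc to lsuc)
open import Relation.Binary.Bundles using (Setoid)
open import Relation.Binary.Core using (Rel)
open import Relation.Binary.Construct.Closure.ReflexiveTransitive
  using (Star; ε; _◅_)
open import Relation.Binary.Definitions using (Decidable; Symmetric; Irreflexive)
open import Relation.Binary.PropositionalEquality.Core using (_≡_)
open import Relation.Binary.Structures using (IsStrictPartialOrder)
open import Relation.Nullary.Decidable.Core using (Dec; yes; no; ⌊_⌋)
open import Relation.Nullary.Negation.Core using (¬_)

-- The real numbers, characterised as an Archimedean, Cauchy-complete ordered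
-- field. Classically this determines ℝ up to unique isomorphism; it is phrased
-- with apartness and a strict order so that constructive reals satisfy it too.

record Reals (a ℓ₁ ℓ₂ : Level) : Set (lsuc (a ⊔ ℓ₁ ⊔ ℓ₂)) where
  field
    heytingField : HeytingField a ℓ₁ ℓ₂

  open HeytingField heytingField public
    using (_#_; heytingCommutativeRing)
  open HeytingCommutativeRing heytingCommutativeRing public
    using (commutativeRing)
  open CommutativeRing commutativeRing public
  open RawMonoidDefs +-rawMonoid public using () renaming (_×_ to _×ℕ_)

  infix 4 _<_ _≤_

  field
    _<_                  : Rel Carrier ℓ₂
    isStrictPartialOrder : IsStrictPartialOrder _≈_ _<_
    #⇔<⊎>                : ∀ {x y} → x # y ⇔ (x < y ⊎ y < x)
    +-monoˡ-<            : ∀ {x y} z → x < y → x + z < y + z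
    *-pos                : ∀ {x y} → 0# < x → 0# < y → 0# < x * y
    archimedean          : ∀ x → ∃[ m ] x < m ×ℕ 1#

  _≤_ : Rel Carrier ℓ₂
  x ≤ y = ¬ (y < x)

  -- Quantifying over both orders of i and j makes absolute values unnecessary.
  Cauchy : (ℕ → Carrier) → Set (a ⊔ ℓ₂)
  Cauchy q = ∀ δ → 0# < δ → ∃[ N ] ∀ i j → N ℕ.≤ i → N ℕ.≤ j → q i - q j < δ

  ConvergesTo : (ℕ → Carrier) → Carrier → Set (a ⊔ ℓ₂)
  ConvergesTo q l =
    ∀ δ → 0# < δ → ∃[ N ] ∀ i → N ℕ.≤ i → (q i - l < δ) × (l - q i < δ)

  field
    complete : ∀ q → Cauchy q → ∃[ l ] ConvergesTo q l

-- A finite simple graph on suc n labelled vertices, so that n = |V| - 1.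

record Graph (n : ℕ) : Set₁ where
  infix 4 _~_ _~?_
  field
    _~_      : Rel (Fin (suc n)) 0ℓ
    _~?_     : Decidable _~_
    ~-sym    : Symmetric _~_
    ~-irrefl : Irreflexive _≡_ _~_

  Vertex : Set
  Vertex = Fin (suc n)

  Edge : Set
  Edge = ∃₂ λ u v → u ~ v

  Walk : Vertex → Vertex → Set
  Walk = Star _~_

  vertices : ∀ {x y} → Walk x y → List Vertex
  vertices {x} ε       = x ∷ []
  vertices {x} (_ ◅ p) = x ∷ vertices p

  IsCycle : ∀ {x y} → Walk x y → Set
  IsCycle {x} {y} _ = x ≡ y

  traversals : Vertex → Vertex → ∀ {x y} → Walk x y → ℕ
  traversals u v ε = 0
  traversals u v (_◅_ {i} {j} _ p) =
    (if ⌊ i ≟ u ⌋ ∧ ⌊ j ≟ v ⌋ then 1 else 0) ℕ.+ traversals u v p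

  Connected : Set
  Connected = ∀ x y → Walk x y

  -- "Acyclic" is in the usual graph-theoretic sense, about simple cycles:
  -- closed walks as in IsCycle always exist. A simple cycle is a walk through at
  -- least three vertices, all distinct, whose endpoints are adjacent.
  Acyclic : Set
  Acyclic = ∀ {x y} (p : Walk x y) →
            Unique (vertices p) → 3 ℕ.≤ length (vertices p) → ¬ (y ~ x)

-- Functions on undirected edges are symmetric functions on ordered adjacent
-- pairs. The irrelevant argument makes the value independent of the proof
-- of adjacency.

record EdgeFunction {n} (G : Graph n) {b ℓ} (X : Setoid b ℓ) : Set (b ⊔ ℓ) where
  open Graph G
  open Setoid X using (Carrier; _≈_)
  field
    at     : ∀ u v → .(u ~ v) → Carrier
    at-sym : ∀ {u v} (e : u ~ v) → at u v e ≈ at v u (~-sym e)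

record Orientation {n} (G : Graph n) : Set where
  open Graph G
  field
    sign      : Vertex → Vertex → Sign
    sign-anti : ∀ {u v} → u ~ v → sign u v ≡ Sign.opposite (sign v u)

record IsSpanningTree {n} (T G : Graph n) : Set where
  private
    module T = Graph T
    module G = Graph G
  field
    ⊆G        : ∀ {u v} → u T.~ v → u G.~ v
    connected : T.Connected
    acyclic   : T.Acyclic

-- ℝ is an instance argument so that the notation below need not mention it.

module _ {a ℓ₁ ℓ₂ : Level} ⦃ ℝ : Reals a ℓ₁ ℓ₂ ⦄ where
  open Reals ℝ

  ℝ^ : ℕ → AbelianGroup a ℓ₁
  ℝ^ n = Pointwise.abelianGroup (Fin n) +-abelianGroup

  Vector : ℕ → Set a
  Vector n = AbelianGroup.Carrier (ℝ^ n)

  module _ {n : ℕ} where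
    open AbelianGroup (ℝ^ n) public
      using ()
      renaming (_≈_ to _≈ᵛ_; _∙_ to _+ᵛ_; _⁻¹ to -ᵛ_; _-_ to _-ᵛ_; ε to 0ᵛ)

    infixr 8 _·_ _±_

    _·_ : Carrier → Vector n → Vector n
    (k · v) i = k * v i

    _±_ : Sign → Vector n → Vector n
    Sign.+ ± v = v
    Sign.- ± v = -ᵛ v

    Spans : {I : Set} → (I → Vector n) → Set (a ⊔ ℓ₁)
    Spans {I} d = ∀ v → Σ[ terms ∈ List (Carrier × I) ]
                    v ≈ᵛ foldr (λ (k , i) acc → (k · d i) +ᵛ acc) 0ᵛ terms

    ∑ : ∀ {m} → (Fin m → Vector n) → Vector n
    ∑ = RawMonoidDefs.sum (AbelianGroup.rawMonoid (ℝ^ n))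

  record PaymentNetwork (n : ℕ) : Set (lsuc 0ℓ ⊔ a ⊔ ℓ₁ ⊔ ℓ₂) where
    field
      graph : Graph n

    open Graph graph public

    field
      connected : Connected
      capacity  : EdgeFunction graph setoid

    open EdgeFunction capacity public using () renaming (at to c; at-sym to c-sym)

    field
      c-nonNeg : ∀ {u v} (e : u ~ v) → 0# ≤ c u v e

  module _ {n : ℕ} (N : PaymentNetwork n) where
    open PaymentNetwork N

    record Configuration : Set (a ⊔ ℓ₁ ⊔ ℓ₂) where
      field
        w         : Vertex → Vertex → Carrier
        w-nonNeg  : ∀ u v → 0# ≤ w u v
        w-edge    : ∀ {u v} (e : u ~ v) → w u v + w v u ≈ c u v e
        w-nonEdge : ∀ {u v} → ¬ (u ~ v) → w u v ≈ 0#

    record Flow : Set (a ⊔ ℓ₂) where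
      field
        f        : ∀ u v → .(u ~ v) → Carrier
        f-nonNeg : ∀ {u v} (e : u ~ v) → 0# ≤ f u v e

  module _ {n : ℕ} {N : PaymentNetwork n} where
    open PaymentNetwork N
    open Configuration using (w)
    open Flow using (f)

    Feasible : Flow N → Configuration N → Set ℓ₂
    Feasible φ C = ∀ {u v} (e : u ~ v) → f φ u v e ≤ w C u v

    -- Only adjacent pairs are constrained: off them both configurations vanish.
    Executes : Flow N → Configuration N → Configuration N → Set ℓ₁
    Executes φ C C′ = ∀ {u v} (e : u ~ v) →
      w C′ u v ≈ (w C u v - f φ u v e) + f φ v u (~-sym e)

    -- No separate condition 0# ≤ k: flows are nonnegative by definition.
    Routes : Carrier → ∀ {x y} → Walk x y → Rel (Configuration N) (a ⊔ ℓ₁ ⊔ ℓ₂)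
    Routes k p C C′ = Σ[ φ ∈ Flow N ]
      (∀ {u v} (e : u ~ v) → f φ u v e ≈ traversals u v p ×ℕ k) ×
      Feasible φ C ×
      Executes φ C C′

    CyclePayment : Rel (Configuration N) (a ⊔ ℓ₁ ⊔ ℓ₂)
    CyclePayment C C′ =
      ∃[ k ] ∃₂ λ x y → Σ[ p ∈ Walk x y ] IsCycle p × Routes k p C C′

    CycleEquivalent : Rel (Configuration N) (a ⊔ ℓ₁ ⊔ ℓ₂)
    CycleEquivalent C C′ = Star CyclePayment C C′ ⊎ Star CyclePayment C′ C

  EdgeVectors : ∀ {n} → Graph n → Set (a ⊔ ℓ₁)
  EdgeVectors {n} G = EdgeFunction G (AbelianGroup.setoid (ℝ^ n))

  module _ {n : ℕ} {G : Graph n} (s : Orientation G) (D : EdgeVectors G) where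
    open Graph G
    open Orientation s
    open EdgeFunction D

    direction : ∀ {x y} → Walk x y → Vector n
    direction ε                 = 0ᵛ
    direction (_◅_ {u} {v} e p) = (sign u v ± at u v e) +ᵛ direction p

    record IsSpanningRepresentation : Set (lsuc 0ℓ ⊔ a ⊔ ℓ₁) where
      field
        zero⇔cycle : ∀ {x y} (p : Walk x y) → (direction p ≈ᵛ 0ᵛ) ⇔ IsCycle p
        tree-spans : ∀ (T : Graph n) (t : IsSpanningTree T G) →
          Spans {I = Graph.Edge T}
            (λ (u , v , e) → at u v (IsSpanningTree.⊆G t e))

  module _ {n : ℕ} {N : PaymentNetwork n}
           (s : Orientation (PaymentNetwork.graph N))
           (D : EdgeVectors (PaymentNetwork.graph N))
           (C : Configuration N) where
    open PaymentNetwork N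
    open Orientation s
    open EdgeFunction D
    open Configuration C

    scoreTerm : ∀ u v → Dec (u ~ v) → Sign → Vector n
    scoreTerm u v (yes e) Sign.+ = w u v · at u v e
    scoreTerm u v (yes _) Sign.- = 0ᵛ
    scoreTerm u v (no _)  _      = 0ᵛ

    score : Vector n
    score = ∑ λ u → ∑ λ v → scoreTerm u v (u ~? v) (sign u v)

{-# OPTIONS --safe #-}

-- Give each ordered edge (u , v) the vector g(u,v) = k D(u,v) if it is positively
-- oriented and 0 otherwise. A payment moves t(u,v) k from (u , v) to (v , u), where t
-- counts traversals, so
--   S(w₂) + ∑ t(u,v) g(u,v) = S(w₁) + ∑ t(v,u) g(u,v).
-- The two sums are the sums of g(u,v) and of g(v,u) over the steps of p, and their
-- difference is k D(p). This is (2), and (1) follows since D vanishes on cycles. For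
-- (3), close both p and q into cycles with the same walk from y back to x.

module Submission where

open import Defs
open import Algebra.Bundles using (AbelianGroup; CommutativeMonoid)
import Algebra.Definitions.RawMonoid as RawMonoidDefs
import Algebra.Properties.CommutativeMonoid.Sum as Sum
import Algebra.Properties.CommutativeSemigroup as CommutativeSemigroupProperties
import Algebra.Properties.Group as GroupProperties
import Algebra.Properties.Monoid.Mult as Mult
import Algebra.Properties.Semiring.Mult as SemiringMult
open import Data.Bool.Base using (if_then_else_; _∧_)
open import Data.Fin.Base using (Fin; punchIn)
open import Data.Fin.Properties using (_≟_; punchInᵢ≢i)
open import Data.Nat.Base as ℕ using (ℕ; zero; suc)
open import Data.Product.Base using (_×_; _,_)
open import Data.Sign.Base as Sign using (Sign)
open import Data.Sum.Base using (inj₁; inj₂)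
open import Function.Base using (_∘_; flip)
open import Function.Bundles using (Equivalence)
open import Level using (Level)
open import Relation.Binary.Construct.Closure.ReflexiveTransitive
  using (Star; ε; _◅_; _◅◅_)
open import Relation.Binary.PropositionalEquality as ≡ using (_≡_; _≢_)
import Relation.Binary.Reasoning.Setoid as SetoidReasoning
open import Relation.Nullary.Decidable.Core using (Dec; yes; no; ⌊_⌋)
open import Relation.Nullary.Negation.Core using (contradiction)
open PaymentNetwork using (graph; Walk)

-- Double sums over vertices and sums along walks

module WalkSums {c ℓ} (M : CommutativeMonoid c ℓ) {n : ℕ} (G : Graph n) where
  open CommutativeMonoid M
    renaming (_∙_ to _+_; ε to 0#; ∙-cong to +-cong; ∙-congˡ to +-congˡ
             ; identityʳ to +-identityʳ)
  open RawMonoidDefs rawMonoid using () renaming (_×_ to _×ᴹ_)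
  open Mult monoid using (×-homo-+)
  open Sum M using (sum; sum-cong-≋; sum-remove; sum-replicate-zero; ∑-distrib-+)
  open Graph G hiding (Walk)
  open SetoidReasoning setoid

  sum-0 : ∀ {m} (f : Fin m → Carrier) → (∀ i → f i ≈ 0#) → sum f ≈ 0#
  sum-0 {m} f f≈0 = trans (sum-cong-≋ f≈0) (sum-replicate-zero m)

  -- `sum-remove` splits off the summand at `i`, and `punchIn i` enumerates exactly the other
  -- indices.
  sum-single : ∀ {m} (f : Fin (suc m) → Carrier) i →
               (∀ j → i ≢ j → f j ≈ 0#) → sum f ≈ f i
  sum-single f i f≈0 = begin
    sum f                       ≈⟨ sum-remove f ⟩
    f i + sum (f ∘ punchIn i)   ≈⟨ +-congˡ (sum-0 _ (λ j → f≈0 _ (punchInᵢ≢i i j ∘ ≡.sym))) ⟩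
    f i + 0#                    ≈⟨ +-identityʳ _ ⟩
    f i                         ∎

  sum₂ : (Vertex → Vertex → Carrier) → Carrier
  sum₂ f = sum λ u → sum λ v → f u v

  sum₂-cong : ∀ {f g} → (∀ u v → f u v ≈ g u v) → sum₂ f ≈ sum₂ g
  sum₂-cong f≈g = sum-cong-≋ λ u → sum-cong-≋ (f≈g u)

  sum₂-distrib-+ : ∀ f g → sum₂ (λ u v → f u v + g u v) ≈ sum₂ f + sum₂ g
  sum₂-distrib-+ f g =
    trans (sum-cong-≋ λ u → ∑-distrib-+ (f u) (g u))
          (∑-distrib-+ (λ u → sum (f u)) (λ u → sum (g u)))

  -- Repeats the summand in the definition of `traversals`, so that the count for a walk starting
  -- with the step from `x` to `y` unfolds definitionally to `indicator x y u v` plus the count for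
  -- the rest.
  indicator : Vertex → Vertex → Vertex → Vertex → ℕ
  indicator x y u v = if ⌊ x ≟ u ⌋ ∧ ⌊ y ≟ v ⌋ then 1 else 0

  sum₂-indicator : ∀ x y (g : Vertex → Vertex → Carrier) →
                   sum₂ (λ u v → indicator x y u v ×ᴹ g u v) ≈ g x y
  sum₂-indicator x y g =
    trans (sum-single (λ u → sum (term u)) x row≢x)
          (trans (sum-single (term x) y col≢y) diagonal)
    where
    term : Vertex → Vertex → Carrier
    term u v = indicator x y u v ×ᴹ g u v

    row≢x : ∀ u → x ≢ u → sum (term u) ≈ 0#
    row≢x u x≢u with x ≟ u
    -- In the `no` case the conjunction reduces to false without inspecting `y ≟ v`, so the whole
    -- row is definitionally zero.
    ... | yes x≡u = contradiction x≡u x≢u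
    ... | no _    = sum-0 {suc n} (λ _ → 0#) λ _ → refl

    col≢y : ∀ v → y ≢ v → term x v ≈ 0#
    -- The conjunction is stuck on `x ≟ x`, so this decision has to be split too; both outcomes give
    -- a zero term.
    col≢y v y≢v with x ≟ x | y ≟ v
    ... | _     | yes y≡v = contradiction y≡v y≢v
    ... | yes _ | no _    = refl
    ... | no _  | no _    = refl

    diagonal : term x y ≈ g x y
    diagonal with x ≟ x | y ≟ y
    ... | yes _ | yes _  = +-identityʳ _
    ... | no x≢x | _     = contradiction ≡.refl x≢x
    ... | yes _ | no y≢y = contradiction ≡.refl y≢y

  sumAlong : (Vertex → Vertex → Carrier) → ∀ {x y} → Graph.Walk G x y → Carrier
  sumAlong g ε                 = 0#
  sumAlong g (_◅_ {u} {v} _ p) = g u v + sumAlong g p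

  -- Induction on the walk: a step adds its indicator to the counts, and by `sum₂-indicator` this
  -- contributes `g` at that step alone.
  sum₂-traversals : ∀ g {x y} (p : Graph.Walk G x y) →
                    sum₂ (λ u v → traversals u v p ×ᴹ g u v) ≈ sumAlong g p
  sum₂-traversals g ε = sum-0 {suc n} _ λ u → sum-0 {suc n} (λ _ → 0#) λ v → refl
  sum₂-traversals g (_◅_ {x} {y} e p) = begin
    sum₂ (λ u v → (indicator x y u v ℕ.+ traversals u v p) ×ᴹ g u v)
      ≈⟨ sum₂-cong (λ u v → ×-homo-+ (g u v) (indicator x y u v) (traversals u v p)) ⟩
    sum₂ (λ u v → indicator x y u v ×ᴹ g u v + traversals u v p ×ᴹ g u v)
      ≈⟨ sum₂-distrib-+ (λ u v → indicator x y u v ×ᴹ g u v)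
                        (λ u v → traversals u v p ×ᴹ g u v) ⟩
    sum₂ (λ u v → indicator x y u v ×ᴹ g u v) + sum₂ (λ u v → traversals u v p ×ᴹ g u v)
      ≈⟨ +-cong (sum₂-indicator x y g) (sum₂-traversals g p) ⟩
    g x y + sumAlong g p
      ∎

-- Multiples of vectors

module _ {a ℓ₁ ℓ₂ : Level} ⦃ ℝ : Reals a ℓ₁ ℓ₂ ⦄ {n : ℕ} where
  open Reals ℝ
  open AbelianGroup (ℝ^ n)
    using () renaming (commutativeMonoid to vectorMonoid; rawMonoid to vectorRawMonoid
                      ; group to vectorGroup; setoid to vectorSetoid; refl to reflᵛ
                      ; sym to symᵛ; trans to transᵛ; assoc to +ᵛ-assoc
                      ; ∙-congˡ to +ᵛ-congˡ; ∙-congʳ to +ᵛ-congʳ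
                      ; identityˡ to +ᵛ-identityˡ; identityʳ to +ᵛ-identityʳ)
  open RawMonoidDefs vectorRawMonoid using () renaming (_×_ to _×ᵛ_)
  open GroupProperties vectorGroup using (∙-cancelʳ; //-rightDividesʳ)
  open SemiringMult semiring using (×-assoc-*)
  open CommutativeSemigroupProperties +-commutativeSemigroup using (interchange)

  ×ᵛ-lookup : ∀ m (v : Vector n) i → (m ×ᵛ v) i ≡ m ×ℕ v i
  ×ᵛ-lookup zero    v i = ≡.refl
  ×ᵛ-lookup (suc m) v i = ≡.cong (v i +_) (×ᵛ-lookup m v i)

  -- Links the repeated addition in walk sums to the flow amounts, which are scalars of the form
  -- `m ×ℕ k`.
  ×ᵛ-· : ∀ m k (v : Vector n) → m ×ᵛ (k · v) ≈ᵛ (m ×ℕ k) · v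
  ×ᵛ-· m k v i = trans (reflexive (×ᵛ-lookup m (k · v) i)) (sym (×-assoc-* m k (v i)))

  -- Directions of walks

  module _ {G : Graph n} (s : Orientation G) (D : EdgeVectors G) where
    open Graph G hiding (Walk)
    open Orientation s
    open EdgeFunction D
    open WalkSums vectorMonoid G using (sumAlong)

    -- This is `scoreTerm` with the weight removed, split into the same clauses so that one case
    -- analysis evaluates both.
    positiveTerm : ∀ u v → Dec (u ~ v) → Sign → Vector n
    positiveTerm u v (yes e) Sign.+ = at u v e
    positiveTerm u v (yes _) Sign.- = 0ᵛ
    positiveTerm u v (no _)  _      = 0ᵛ

    positivePart : Vertex → Vertex → Vector n
    positivePart u v = positiveTerm u v (u ~? v) (sign u v)

    -- Exactly one of the two orders of an edge is positive. Writing this with addition instead of a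
    -- difference lets it be summed along walks in a commutative monoid.
    ±-positivePart : ∀ {u v} (e : u ~ v) →
      ((sign u v ± at u v e) +ᵛ positivePart v u) ≈ᵛ positivePart u v
    ±-positivePart {u} {v} e i
      -- Abstracting `sign-anti e` along with the signs rules out equal signs. The adjacency proof
      -- found by the decision may differ from `e`, but `at` is irrelevant in it.
      with u ~? v | v ~? u | sign u v | sign v u | sign-anti e
    ... | no ¬e | _     | _      | _      | _ = contradiction e ¬e
    ... | yes _ | no ¬e | _      | _      | _ = contradiction (~-sym e) ¬e
    ... | yes _ | yes _ | Sign.+ | Sign.- | _ = +-identityʳ _
    ... | yes _ | yes _ | Sign.- | Sign.+ | _ = trans (+-congˡ (sym (at-sym e i))) (-‿inverseˡ _)

    -- Induction on the walk, adding `k` times `±-positivePart` at each step.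
    direction-sumAlong : ∀ k {x y} (p : Graph.Walk G x y) →
      ((k · direction s D p) +ᵛ sumAlong (λ u v → k · positivePart v u) p) ≈ᵛ
      sumAlong (λ u v → k · positivePart u v) p
    direction-sumAlong k ε i = trans (+-identityʳ _) (zeroʳ k)
    direction-sumAlong k (_◅_ {u} {v} e p) i = begin
      k * (d + d′) + (k * g v u i + r)       ≈⟨ +-congʳ (distribˡ k d d′) ⟩
      (k * d + k * d′) + (k * g v u i + r)   ≈⟨ interchange _ _ _ _ ⟩
      (k * d + k * g v u i) + (k * d′ + r)   ≈⟨ +-congʳ (distribˡ k d _) ⟨
      k * (d + g v u i) + (k * d′ + r)
        ≈⟨ +-cong (*-congˡ (±-positivePart e i)) (direction-sumAlong k p i) ⟩
      k * g u v i + sumAlong (λ u v → k · positivePart u v) p i ∎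
      where
      open SetoidReasoning setoid
      g  = positivePart
      d  = (sign u v ± at u v e) i
      d′ = direction s D p i
      r  = sumAlong (λ u v → k · positivePart v u) p i

    direction-◅◅ : ∀ {x y z} (p : Graph.Walk G x y) (q : Graph.Walk G y z) →
      direction s D (p ◅◅ q) ≈ᵛ (direction s D p +ᵛ direction s D q)
    direction-◅◅ ε       q = symᵛ (+ᵛ-identityˡ _)
    direction-◅◅ (e ◅ p) q =
      transᵛ (+ᵛ-congˡ (direction-◅◅ p q)) (symᵛ (+ᵛ-assoc _ _ _))

    module _ (rep : IsSpanningRepresentation s D) where
      open IsSpanningRepresentation rep

      direction-cycle : ∀ {x y} (p : Graph.Walk G x y) → x ≡ y → direction s D p ≈ᵛ 0ᵛ
      direction-cycle p = Equivalence.from (zero⇔cycle p)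

      direction-unique : Graph.Connected G → ∀ {x y} (p q : Graph.Walk G x y) →
                         direction s D p ≈ᵛ direction s D q
      direction-unique connected {x} {y} p q =
        ∙-cancelʳ (direction s D r) _ _ (transᵛ (closed p) (symᵛ (closed q)))
        where
        r = connected y x

        closed : ∀ p → (direction s D p +ᵛ direction s D r) ≈ᵛ 0ᵛ
        closed p = transᵛ (symᵛ (direction-◅◅ p r)) (direction-cycle (p ◅◅ r) ≡.refl)

  -- The effect of payments on the score

  module _ (N : PaymentNetwork n) (s : Orientation (graph N)) (D : EdgeVectors (graph N)) where
    open PaymentNetwork N hiding (Walk)
    open Orientation s
    open EdgeFunction D
    open Configuration using (w)
    open WalkSums vectorMonoid (graph N)
    open Sum vectorMonoid using (∑-comm)

    -- The equation for executing a flow, with the outgoing flow moved to the other side so that no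
    -- subtraction remains.
    balance : ∀ k {x y} (p : Walk N x y) (C₁ C₂ : Configuration N) →
              Routes k p C₁ C₂ → ∀ {u v} → u ~ v →
              w C₂ u v + traversals u v p ×ℕ k ≈ w C₁ u v + traversals v u p ×ℕ k
    balance k p C₁ C₂ (φ , amount , _ , executes) {u} {v} e = begin
      w C₂ u v + t                     ≈⟨ +-cong (executes e) (sym (amount e)) ⟩
      ((w C₁ u v - φᵤᵥ) + φᵥᵤ) + φᵤᵥ   ≈⟨ xy∙z≈xz∙y _ _ _ ⟩
      ((w C₁ u v - φᵤᵥ) + φᵤᵥ) + φᵥᵤ   ≈⟨ +-congʳ (//-rightDividesˡ _ _) ⟩
      w C₁ u v + φᵥᵤ                   ≈⟨ +-congˡ (amount (~-sym e)) ⟩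
      w C₁ u v + traversals v u p ×ℕ k ∎
      where
      open SetoidReasoning setoid
      open CommutativeSemigroupProperties +-commutativeSemigroup using (xy∙z≈xz∙y)
      open GroupProperties +-group using (//-rightDividesˡ)
      t   = traversals u v p ×ℕ k
      φᵤᵥ = Flow.f φ u v e
      φᵥᵤ = Flow.f φ v u (~-sym e)

    -- On a positive edge this is `balance` multiplied by the edge vector; elsewhere both sides
    -- vanish. The decision and the sign are variables, so that matching on them reduces `scoreTerm`
    -- and `positiveTerm` together.
    scoreTerm-balance : ∀ k {x y} (p : Walk N x y) (C₁ C₂ : Configuration N) →
      Routes k p C₁ C₂ → ∀ u v d σ →
      (scoreTerm s D C₂ u v d σ +ᵛ (traversals u v p ×ᵛ (k · positiveTerm s D u v d σ))) ≈ᵛ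
      (scoreTerm s D C₁ u v d σ +ᵛ (traversals v u p ×ᵛ (k · positiveTerm s D u v d σ)))
    scoreTerm-balance k p C₁ C₂ routes u v = term
      where
      open SetoidReasoning setoid

      vanishing : ∀ m m′ →
        (0ᵛ +ᵛ (m ×ᵛ (k · 0ᵛ))) ≈ᵛ (0ᵛ +ᵛ (m′ ×ᵛ (k · 0ᵛ)))
      vanishing m m′ i =
        +-congˡ (trans (trans (×ᵛ-· m k 0ᵛ i) (zeroʳ _))
                       (sym (trans (×ᵛ-· m′ k 0ᵛ i) (zeroʳ _))))

      term : ∀ d σ → _
      term (no _)  _      = vanishing (traversals u v p) (traversals v u p)
      term (yes _) Sign.- = vanishing (traversals u v p) (traversals v u p)
      term (yes e) Sign.+ i = begin
        w C₂ u v * x + (traversals u v p ×ᵛ (k · at u v e)) i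
          ≈⟨ +-congˡ (×ᵛ-· (traversals u v p) k (at u v e) i) ⟩
        w C₂ u v * x + (traversals u v p ×ℕ k) * x ≈⟨ distribʳ x _ _ ⟨
        (w C₂ u v + traversals u v p ×ℕ k) * x     ≈⟨ *-congʳ (balance k p C₁ C₂ routes e) ⟩
        (w C₁ u v + traversals v u p ×ℕ k) * x     ≈⟨ distribʳ x _ _ ⟩
        w C₁ u v * x + (traversals v u p ×ℕ k) * x
          ≈⟨ +-congˡ (×ᵛ-· (traversals v u p) k (at u v e) i) ⟨
        w C₁ u v * x + (traversals v u p ×ᵛ (k · at u v e)) i ∎
        where x = at u v e i

    score-route : ∀ k {x y} (p : Walk N x y) (C₁ C₂ : Configuration N) →
                  Routes k p C₁ C₂ →
                  (score s D C₁ -ᵛ (k · direction s D p)) ≈ᵛ score s D C₂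
    score-route k p C₁ C₂ routes = begin
      S₁ -ᵛ kd          ≈⟨ +ᵛ-congʳ S₂+kd≈S₁ ⟨
      (S₂ +ᵛ kd) -ᵛ kd  ≈⟨ //-rightDividesʳ kd S₂ ⟩
      S₂                ∎
      where
      open SetoidReasoning vectorSetoid
      S₁ = score s D C₁
      S₂ = score s D C₂
      kd = k · direction s D p

      g : Vertex → Vertex → Vector n
      g u v = k · positivePart s D u v

      term : Configuration N → Vertex → Vertex → Vector n
      term C u v = scoreTerm s D C u v (u ~? v) (sign u v)

      S₂+kd≈S₁ : (S₂ +ᵛ kd) ≈ᵛ S₁
      -- Adding the reversed walk sum to both sides turns `kd` into `sumAlong g p`; both walk sums
      -- then become double sums that can be compared term by term.
      S₂+kd≈S₁ = ∙-cancelʳ (sumAlong (flip g) p) _ _ (begin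
        (S₂ +ᵛ kd) +ᵛ sumAlong (flip g) p ≈⟨ +ᵛ-assoc _ _ _ ⟩
        S₂ +ᵛ (kd +ᵛ sumAlong (flip g) p) ≈⟨ +ᵛ-congˡ (direction-sumAlong s D k p) ⟩
        S₂ +ᵛ sumAlong g p                ≈⟨ +ᵛ-congˡ (sum₂-traversals g p) ⟨
        S₂ +ᵛ sum₂ (λ u v → traversals u v p ×ᵛ g u v)
          ≈⟨ sum₂-distrib-+ (term C₂) (λ u v → traversals u v p ×ᵛ g u v) ⟨
        sum₂ (λ u v → term C₂ u v +ᵛ (traversals u v p ×ᵛ g u v))
          ≈⟨ sum₂-cong (λ u v → scoreTerm-balance k p C₁ C₂ routes u v (u ~? v) (sign u v)) ⟩
        sum₂ (λ u v → term C₁ u v +ᵛ (traversals v u p ×ᵛ g u v))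
          ≈⟨ sum₂-distrib-+ (term C₁) (λ u v → traversals v u p ×ᵛ g u v) ⟩
        S₁ +ᵛ sum₂ (λ u v → traversals v u p ×ᵛ g u v)
          -- Exchanging the two summations moves the reversal from the traversal counts to `g`.
          ≈⟨ +ᵛ-congˡ (∑-comm (λ u v → traversals v u p ×ᵛ g u v)) ⟩
        S₁ +ᵛ sum₂ (λ u v → traversals u v p ×ᵛ g v u)
          ≈⟨ +ᵛ-congˡ (sum₂-traversals (flip g) p) ⟩
        S₁ +ᵛ sumAlong (flip g) p ∎)

    module _ (rep : IsSpanningRepresentation s D) where

      score-cyclePayment : ∀ {C₁ C₂} → CyclePayment C₁ C₂ → score s D C₁ ≈ᵛ score s D C₂
      score-cyclePayment {C₁} {C₂} (k , x , y , p , x≡y , routes) = begin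
        score s D C₁               ≈⟨ //-rightDividesʳ kd _ ⟨
        (score s D C₁ +ᵛ kd) -ᵛ kd ≈⟨ +ᵛ-congʳ (transᵛ (+ᵛ-congˡ kd≈0) (+ᵛ-identityʳ _)) ⟩
        score s D C₁ -ᵛ kd         ≈⟨ score-route k p C₁ C₂ routes ⟩
        score s D C₂               ∎
        where
        open SetoidReasoning vectorSetoid
        kd = k · direction s D p

        kd≈0 : kd ≈ᵛ 0ᵛ
        kd≈0 i = trans (*-congˡ (direction-cycle s D rep p x≡y i)) (zeroʳ k)

      score-cyclePayments : ∀ {C₁ C₂} → Star CyclePayment C₁ C₂ →
                            score s D C₁ ≈ᵛ score s D C₂
      score-cyclePayments ε              = reflᵛ
      score-cyclePayments (step ◅ steps) =
        transᵛ (score-cyclePayment step) (score-cyclePayments steps)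

      -- Either configuration may be the one that is reached, and equality of scores is symmetric.
      score-cycleEquivalent : ∀ C₁ C₂ → CycleEquivalent C₁ C₂ →
                              score s D C₁ ≈ᵛ score s D C₂
      score-cycleEquivalent _ _ (inj₁ steps) = score-cyclePayments steps
      score-cycleEquivalent _ _ (inj₂ steps) = symᵛ (score-cyclePayments steps)

theorem3p5 : ∀ {a ℓ₁ ℓ₂ : Level} ⦃ ℝ : Reals a ℓ₁ ℓ₂ ⦄ (n : ℕ) (N : PaymentNetwork n)
    (s : Orientation (graph N)) (D : EdgeVectors (graph N)) →
    IsSpanningRepresentation s D →
    (∀ (C₁ C₂ : Configuration N) → CycleEquivalent C₁ C₂ →
    score s D C₁ ≈ᵛ score s D C₂)
    × (∀ (k : Reals.Carrier ℝ) {x y : Fin (suc n)} (p : Walk N x y) (C₁ C₂ : Configuration N) →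
    Routes k p C₁ C₂ →
    (score s D C₁ -ᵛ (k · direction s D p)) ≈ᵛ score s D C₂)
    × (∀ {x y : Fin (suc n)} (p q : Walk N x y) →
    direction s D p ≈ᵛ direction s D q)
theorem3p5 n N s D rep =
  score-cycleEquivalent N s D rep ,
  score-route N s D ,
  direction-unique s D rep (PaymentNetwork.connected N)
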